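{- The logic $\mathsf L(\{\mathfrak R_2,\mathfrak F_2\})=\mathsf L(\mathfrak R_2)\cap\mathsf L(\mathfrak F_2)$ has nullary unification.
   Context: A frame is a finite poset with a least element; for a class $\mathbf F$ of frames $\mathsf L(\mathbf F)$ is the set of intuitionistic formulas valid in every Kripke model over every frame of $\mathbf F$. $\mathfrak F_2$ is the three-element fork (a root with two incomparable maximal elements above it); $\mathfrak R_2$ is the rhombus ($\mathfrak F_2$ with a top element added above everything). Unification in a logic $\mathsf L$ is nullary if some $\mathsf L$-unifiable formula has no minimal (w.r.t. inclusion) complete set of unifiers, where a set $\Sigma$ of unifiers of $A$ is complete if every unifier $\mu$ of $A$ satisfies $\alpha\circ\varepsilon=_{\mathsf L}\mu$ for some $\varepsilon\in\Sigma$ and substitution $\alpha$. -}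

module Defs where

open import Data.Nat using (ℕ)
open import Data.Bool using (Bool; true)
open import Data.Product using (Σ; _×_; ∃)
open import Data.Sum using (_⊎_)
open import Data.Empty using (⊥)
open import Data.Unit using (⊤)
open import Relation.Binary.PropositionalEquality using (_≡_)
open import Relation.Nullary using (¬_)

infixr 6 _∧'_
infixr 5 _∨'_
infixr 4 _⇒_

data Fm : Set where
  var  : ℕ → Fm
  ⊥'   : Fm
  _∧'_ : Fm → Fm → Fm
  _∨'_ : Fm → Fm → Fm
  _⇒_  : Fm → Fm → Fm

_⇔_ : Fm → Fm → Fm
A ⇔ B = (A ⇒ B) ∧' (B ⇒ A)

data _occursIn_ (x : ℕ) : Fm → Set where
  here  : x occursIn var x
  ∧l    : ∀ {A B} → x occursIn A → x occursIn (A ∧' B)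
  ∧r    : ∀ {A B} → x occursIn B → x occursIn (A ∧' B)
  ∨l    : ∀ {A B} → x occursIn A → x occursIn (A ∨' B)
  ∨r    : ∀ {A B} → x occursIn B → x occursIn (A ∨' B)
  ⇒l    : ∀ {A B} → x occursIn A → x occursIn (A ⇒ B)
  ⇒r    : ∀ {A B} → x occursIn B → x occursIn (A ⇒ B)

Subst : Set
Subst = ℕ → Fm

sub : Subst → Fm → Fm
sub σ (var x)  = σ x
sub σ ⊥'       = ⊥'
sub σ (A ∧' B) = sub σ A ∧' sub σ B
sub σ (A ∨' B) = sub σ A ∨' sub σ B
sub σ (A ⇒ B)  = sub σ A ⇒ sub σ B

_∘ₛ_ : Subst → Subst → Subst
(α ∘ₛ ε) x = sub α (ε x)

record Frame : Set₁ where
  field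
    W   : Set
    _≼_ : W → W → Set

module _ (F : Frame) where
  open Frame F

  Valuation : Set
  Valuation = ℕ → W → Bool

  Monotone : Valuation → Set
  Monotone V = ∀ x w v → w ≼ v → V x w ≡ true → V x v ≡ true

  Forces : Valuation → W → Fm → Set
  Forces V w (var x)  = V x w ≡ true
  Forces V w (⊥')     = ⊥
  Forces V w (A ∧' B) = (Forces V w (A)) × (Forces V w (B))
  Forces V w (A ∨' B) = (Forces V w (A)) ⊎ (Forces V w (B))
  Forces V w (A ⇒ B)  = ∀ v → w ≼ v → Forces V v (A) → Forces V v (B)

  ValidIn : Fm → Set
  ValidIn A = ∀ (V : Valuation) → Monotone V → ∀ w → Forces V w (A)

data F₂W : Set where
  r a b : F₂W

_≤F_ : F₂W → F₂W → Set
r ≤F _ = ⊤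
a ≤F a = ⊤
b ≤F b = ⊤
_ ≤F _ = ⊥

𝔉₂ : Frame
𝔉₂ = record { W = F₂W ; _≼_ = _≤F_ }

data R₂W : Set where
  r a b t : R₂W

_≤R_ : R₂W → R₂W → Set
r ≤R _ = ⊤
a ≤R a = ⊤
a ≤R t = ⊤
b ≤R b = ⊤
b ≤R t = ⊤
t ≤R t = ⊤
_ ≤R _ = ⊥

ℜ₂ : Frame
ℜ₂ = record { W = R₂W ; _≼_ = _≤R_ }

Logic : Set₁
Logic = Fm → Set

L-R₂F₂ : Logic
L-R₂F₂ A = ValidIn ℜ₂ A × ValidIn 𝔉₂ A

module Unification (L : Logic) where

  Unifier : Fm → Subst → Set
  Unifier A σ = L (sub σ A)

  Unifiable : Fm → Set
  Unifiable A = ∃ λ σ → Unifier A σ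

  SubstSet : Set₁
  SubstSet = Subst → Set

  EqL-on : Fm → Subst → Subst → Set
  EqL-on A σ τ = ∀ x → x occursIn A → L (σ x ⇔ τ x)

  Complete : Fm → SubstSet → Set
  Complete A Σs =
    (∀ σ → Σs σ → Unifier A σ) ×
    (∀ μ → Unifier A μ →
       Σ Subst λ ε → Σs ε × Σ Subst λ α → EqL-on A (α ∘ₛ ε) μ)

  _⊆ₛ_ : SubstSet → SubstSet → Set
  Σ₁ ⊆ₛ Σ₂ = ∀ σ → Σ₁ σ → Σ₂ σ

  MinimalComplete : Fm → SubstSet → Set₁
  MinimalComplete A Σs =
    Complete A Σs ×
    ¬ (Σ SubstSet λ Σ' → Σ' ⊆ₛ Σs × Complete A Σ' ×
         Σ Subst λ σ → Σs σ × ¬ Σ' σ)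

  NullaryUnification : Set₁
  NullaryUnification =
    Σ Fm λ A → Unifiable A × ¬ (Σ SubstSet λ Σs → MinimalComplete A Σs)

{-# OPTIONS --safe #-}

-- Take A = (x ∨ y) ∧ ¬¬x ∧ ¬¬y.  Any two unifiers μ, ν of A have a common
-- generalisation, (¬¬z → μ) ∧ (¬z → ν): where neither ¬¬z nor ¬z is forced, only
-- maximal points lie strictly above, and there both x and y hold.  So if some
-- complete set has a member ε and ν is a unifier that is not an instance of ε, the
-- members of the set of which ν is an instance still form a complete set, without ε.
--
-- Such a ν is  x = ⋀_{i<k} (¬¬pᵢ ∨ ¬pᵢ),  y = x → (q ∨ ¬q)  for k large.  At the root
-- of a fork whose leaves differ on some pᵢ, x fails; below every leaf with q true
-- there is a point at which y fails.  If ν were an instance of ε via α, then with k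
-- larger than the number of labels in the variables of ε, two of the leaves would
-- get the same label under α.  Under α the fork over these two leaves then collapses
-- to a chain, and joining that chain to a chain at whose root y fails gives a
-- rhombus at whose root ε makes both x and y fail.
module Submission where

open import Defs
open import Data.Bool using (Bool; true; false)
import Data.Bool.Properties as Bool
open import Data.Empty using (⊥-elim)
open import Data.Fin using (Fin; toℕ; fromℕ<; funToFin; finToFun)
open import Data.Fin.Properties using (pigeonhole; toℕ<n; toℕ-fromℕ<; finToFun-funToFin; 2↔Bool)
  renaming (<⇒≢ to <⇒≢ᶠ; toℕ-injective to toℕ-injectiveᶠ)
open import Data.Nat using (ℕ; zero; suc; _<_; _⊔_; _^_; _≟_; s≤s)
open import Data.Nat.Properties using (≤-refl; ≤-trans; m≤m⊔n; m≤n⊔m; m≤n⇒m<n∨m≡n; n<1+n)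
open import Data.Product using (Σ; ∃; _×_; _,_; proj₁; proj₂)
open import Data.Sum using (_⊎_; inj₁; inj₂) renaming (map to map-⊎)
open import Data.Unit using (⊤; tt)
open import Function using (_∘_)
open import Function.Bundles using (mk⇔; module Equivalence; module Inverse) renaming (_⇔_ to _⟺_)
open import Relation.Binary.PropositionalEquality using (_≡_; _≢_; refl; sym; trans; cong; cong₂; subst; module ≡-Reasoning)
open import Relation.Nullary using (¬_; Dec; yes; no; does)
open import Relation.Nullary.Decidable using (dec-true; does-⇔; map′; _×-dec_; _⊎-dec_; _→-dec_)

open Equivalence using (to; from)
open Unification L-R₂F₂

-- Formulas, substitutions and bounds on variables

infix 7 ¬'_

¬'_ : Fm → Fm
¬' A = A ⇒ ⊥'

⊤' : Fm
⊤' = ⊥' ⇒ ⊥'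

does-true : {P : Set} (P? : Dec P) → does P? ≡ true → P
does-true (yes p) _ = p

sub-∘ : ∀ σ τ A → sub (σ ∘ₛ τ) A ≡ sub σ (sub τ A)
sub-∘ σ τ (var x)  = refl
sub-∘ σ τ ⊥'       = refl
sub-∘ σ τ (A ∧' B) = cong₂ _∧'_ (sub-∘ σ τ A) (sub-∘ σ τ B)
sub-∘ σ τ (A ∨' B) = cong₂ _∨'_ (sub-∘ σ τ A) (sub-∘ σ τ B)
sub-∘ σ τ (A ⇒ B)  = cong₂ _⇒_ (sub-∘ σ τ A) (sub-∘ σ τ B)

sub-var : ∀ A → sub var A ≡ A
sub-var (var x)  = refl
sub-var ⊥'       = refl
sub-var (A ∧' B) = cong₂ _∧'_ (sub-var A) (sub-var B)
sub-var (A ∨' B) = cong₂ _∨'_ (sub-var A) (sub-var B)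
sub-var (A ⇒ B)  = cong₂ _⇒_ (sub-var A) (sub-var B)

varBound : Fm → ℕ
varBound (var x)  = suc x
varBound ⊥'       = 0
varBound (A ∧' B) = varBound A ⊔ varBound B
varBound (A ∨' B) = varBound A ⊔ varBound B
varBound (A ⇒ B)  = varBound A ⊔ varBound B

occursIn⇒<varBound : ∀ {x A} → x occursIn A → x < varBound A
occursIn⇒<varBound here   = ≤-refl
occursIn⇒<varBound (∧l o) = ≤-trans (occursIn⇒<varBound o) (m≤m⊔n _ _)
occursIn⇒<varBound (∧r {A} o) = ≤-trans (occursIn⇒<varBound o) (m≤n⊔m (varBound A) _)
occursIn⇒<varBound (∨l o) = ≤-trans (occursIn⇒<varBound o) (m≤m⊔n _ _)
occursIn⇒<varBound (∨r {A} o) = ≤-trans (occursIn⇒<varBound o) (m≤n⊔m (varBound A) _)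
occursIn⇒<varBound (⇒l o) = ≤-trans (occursIn⇒<varBound o) (m≤m⊔n _ _)
occursIn⇒<varBound (⇒r {A} o) = ≤-trans (occursIn⇒<varBound o) (m≤n⊔m (varBound A) _)

-- Kripke semantics over decidable preorders

record IsFinitePreorder (F : Frame) : Set₁ where
  open Frame F
  field
    ≼-refl  : ∀ w → w ≼ w
    ≼-trans : ∀ u v w → u ≼ v → v ≼ w → u ≼ w
    _≼?_    : ∀ u v → Dec (u ≼ v)
    all?    : {P : W → Set} → (∀ w → Dec (P w)) → Dec (∀ w → P w)

module Kripke {F : Frame} (isFin : IsFinitePreorder F) where
  open Frame F
  open IsFinitePreorder isFin

  forces? : ∀ V w A → Dec (Forces F V w A)
  forces? V w (var x)  = V x w Bool.≟ true
  forces? V w ⊥'       = no λ ()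
  forces? V w (A ∧' B) = forces? V w A ×-dec forces? V w B
  forces? V w (A ∨' B) = forces? V w A ⊎-dec forces? V w B
  forces? V w (A ⇒ B)  = all? λ v → (w ≼? v) →-dec (forces? V v A →-dec forces? V v B)

  -- Valuations are Boolean, so pulling one back along a substitution rests on the decidability of
  -- forcing, which comes from `all?`.
  _⟨_⟩ : Valuation F → Subst → Valuation F
  (V ⟨ σ ⟩) x w = does (forces? V w (σ x))

  forces-sub : ∀ V σ A w → Forces F (V ⟨ σ ⟩) w A ⟺ Forces F V w (sub σ A)
  forces-sub V σ (var x)  w = mk⇔ (does-true (forces? V w (σ x))) (dec-true (forces? V w (σ x)))
  forces-sub V σ ⊥'       w = mk⇔ (λ ()) (λ ())
  forces-sub V σ (A ∧' B) w = mk⇔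
    (λ (p , q) → to (forces-sub V σ A w) p , to (forces-sub V σ B w) q)
    (λ (p , q) → from (forces-sub V σ A w) p , from (forces-sub V σ B w) q)
  forces-sub V σ (A ∨' B) w = mk⇔
    (map-⊎ (to (forces-sub V σ A w)) (to (forces-sub V σ B w)))
    (map-⊎ (from (forces-sub V σ A w)) (from (forces-sub V σ B w)))
  forces-sub V σ (A ⇒ B)  w = mk⇔
    (λ f v w≼v p → to (forces-sub V σ B v) (f v w≼v (from (forces-sub V σ A v) p)))
    (λ f v w≼v p → from (forces-sub V σ B v) (f v w≼v (to (forces-sub V σ A v) p)))

  persistent : ∀ {V} → Monotone F V → ∀ A {w v} → w ≼ v → Forces F V w A → Forces F V v A
  persistent mon (var x)  w≼v p        = mon x _ _ w≼v p
  persistent mon (A ∧' B) w≼v (p , q)  = persistent mon A w≼v p , persistent mon B w≼v q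
  persistent mon (A ∨' B) w≼v p        = map-⊎ (persistent mon A w≼v) (persistent mon B w≼v) p
  persistent mon (A ⇒ B)  w≼v f u v≼u  = f u (≼-trans _ _ _ w≼v v≼u)

  ⟨⟩-monotone : ∀ {V} σ → Monotone F V → Monotone F (V ⟨ σ ⟩)
  ⟨⟩-monotone {V} σ mon x w v w≼v p =
    dec-true (forces? V v (σ x)) (persistent mon (σ x) w≼v (does-true (forces? V w (σ x)) p))

  valid-sub : ∀ σ A → ValidIn F A → ValidIn F (sub σ A)
  valid-sub σ A valid V mon w = to (forces-sub V σ A w) (valid (V ⟨ σ ⟩) (⟨⟩-monotone σ mon) w)

  ⇔-trans-valid : ∀ {A B C} → ValidIn F (A ⇔ B) → ValidIn F (B ⇔ C) → ValidIn F (A ⇔ C)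
  ⇔-trans-valid AB BC V mon w with AB V mon w | BC V mon w
  ... | f , f⁻¹ | g , g⁻¹ =
    (λ v w≼v p → g v w≼v (f v w≼v p)) , (λ v w≼v p → f⁻¹ v w≼v (g⁻¹ v w≼v p))

  ¬¬-intro : ∀ {V} → Monotone F V → ∀ A {w} → Forces F V w A → Forces F V w (¬' ¬' A)
  ¬¬-intro mon A p v w≼v ¬p = ¬p v (≼-refl v) (persistent mon A w≼v p)

  ¬¬-∧ : ∀ {V} → Monotone F V → ∀ A B {w} →
         Forces F V w (¬' ¬' A) → Forces F V w (¬' ¬' B) → Forces F V w (¬' ¬' (A ∧' B))
  ¬¬-∧ mon A B ¬¬p ¬¬q v w≼v ¬pq = ¬¬p v w≼v λ u v≼u p →
    ¬¬q u (≼-trans _ _ _ w≼v v≼u) λ u′ u≼u′ q →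
    ¬pq u′ (≼-trans _ _ _ v≼u u≼u′) (persistent mon A u≼u′ p , q)

  ¬¬-mono : ∀ {V w} A B → (∀ v → w ≼ v → Forces F V v A → Forces F V v B) →
            Forces F V w (¬' ¬' A) → Forces F V w (¬' ¬' B)
  ¬¬-mono A B f ¬¬p v w≼v ¬q = ¬¬p v w≼v λ u v≼u p → ¬q u v≼u (f u (≼-trans _ _ _ w≼v v≼u) p)

  ¬¬-wlem : ∀ {V} → Monotone F V → ∀ A w → Forces F V w (¬' ¬' (¬' ¬' A ∨' ¬' A))
  ¬¬-wlem mon A w v _ k = k v (≼-refl v) (inj₂ λ u v≼u p →
    k u v≼u (inj₁ (¬¬-intro mon A p)))

  ¬¬-lem : ∀ {V} A w → Forces F V w (¬' ¬' (A ∨' ¬' A))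
  ¬¬-lem A w v _ k = k v (≼-refl v) (inj₂ λ u v≼u p → k u v≼u (inj₁ p))

-- P-morphisms

record PMorphism (F G : Frame) : Set where
  open Frame
  field
    map  : W F → W G
    mono : ∀ w v → _≼_ F w v → _≼_ G (map w) (map v)
    back : ∀ w v → _≼_ G (map w) v → Σ (W F) λ u → _≼_ F w u × map u ≡ v

module _ {F G : Frame} (f : PMorphism F G) where
  open PMorphism f

  -- The valuations are compared only on the variables of `A`, because the pigeonhole argument below
  -- yields agreement on finitely many variables only.
  forces-map : ∀ V V′ A → (∀ x → x occursIn A → ∀ w → V x w ≡ V′ x (map w)) →
               ∀ w → Forces F V w A ⟺ Forces G V′ (map w) A
  forces-map V V′ (var x)  eq w = mk⇔ (trans (sym (eq x here w))) (trans (eq x here w))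
  forces-map V V′ ⊥'       eq w = mk⇔ (λ ()) (λ ())
  forces-map V V′ (A ∧' B) eq w = mk⇔
    (λ (p , q) → to ihA p , to ihB q) (λ (p , q) → from ihA p , from ihB q)
    where ihA = forces-map V V′ A (λ x o → eq x (∧l o)) w
          ihB = forces-map V V′ B (λ x o → eq x (∧r o)) w
  forces-map V V′ (A ∨' B) eq w = mk⇔ (map-⊎ (to ihA) (to ihB)) (map-⊎ (from ihA) (from ihB))
    where ihA = forces-map V V′ A (λ x o → eq x (∨l o)) w
          ihB = forces-map V V′ B (λ x o → eq x (∨r o)) w
  forces-map V V′ (A ⇒ B)  eq w = mk⇔
    (λ g v w≼v p → forth g v (back w v w≼v) p)
    (λ g v w≼v p → from (ihB v) (g (map v) (mono w v w≼v) (to (ihA v) p)))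
    where
    ihA = forces-map V V′ A (λ x o → eq x (⇒l o))
    ihB = forces-map V V′ B (λ x o → eq x (⇒r o))
    forth : Forces F V w (A ⇒ B) → ∀ v → (Σ (Frame.W F) λ u → Frame._≼_ F w u × map u ≡ v) →
            Forces G V′ v A → Forces G V′ v B
    forth g v (u , w≼u , refl) p = to (ihB u) (g u w≼u (from (ihA u) p))

-- Local shape of the fork and the rhombus

module _ {F : Frame} where
  open Frame F

  Confluent : W → Set
  Confluent w = Σ W λ m → ∀ v → w ≼ v → v ≼ m

  Forked : W → Set
  Forked w = ∀ v → w ≼ v → v ≡ w ⊎ (∀ u → v ≼ u → u ≡ v)

record Admissible (F : Frame) : Set₁ where
  field
    isFinitePreorder : IsFinitePreorder F
    shape            : ∀ w → Confluent {F} w ⊎ Forked {F} w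

𝔉₂-isFinitePreorder : IsFinitePreorder 𝔉₂
𝔉₂-isFinitePreorder = record
  { ≼-refl = λ { r → tt ; a → tt ; b → tt }
  ; ≼-trans = λ { r _ _ _ _ → tt ; a a a _ _ → tt ; b b b _ _ → tt }
  ; _≼?_ = λ { r _ → yes tt
             ; a r → no λ () ; a a → yes tt ; a b → no λ ()
             ; b r → no λ () ; b a → no λ () ; b b → yes tt }
  ; all? = all?
  }
  where
  all? : {P : F₂W → Set} → (∀ w → Dec (P w)) → Dec (∀ w → P w)
  all? P? with P? r | P? a | P? b
  ... | no ¬p | _ | _ = no λ p → ¬p (p r)
  ... | yes _ | no ¬p | _ = no λ p → ¬p (p a)
  ... | yes _ | yes _ | no ¬p = no λ p → ¬p (p b)
  ... | yes pr | yes pa | yes pb = yes λ { r → pr ; a → pa ; b → pb }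

ℜ₂-isFinitePreorder : IsFinitePreorder ℜ₂
ℜ₂-isFinitePreorder = record
  { ≼-refl = λ { r → tt ; a → tt ; b → tt ; t → tt }
  ; ≼-trans = λ { r _ _ _ _ → tt ; a a a _ _ → tt ; a a t _ _ → tt ; a t t _ _ → tt
                ; b b b _ _ → tt ; b b t _ _ → tt ; b t t _ _ → tt ; t t t _ _ → tt }
  ; _≼?_ = λ { r _ → yes tt
             ; a r → no λ () ; a a → yes tt ; a b → no λ () ; a t → yes tt
             ; b r → no λ () ; b a → no λ () ; b b → yes tt ; b t → yes tt
             ; t r → no λ () ; t a → no λ () ; t b → no λ () ; t t → yes tt }
  ; all? = all?
  }
  where
  all? : {P : R₂W → Set} → (∀ w → Dec (P w)) → Dec (∀ w → P w)
  all? P? with P? r | P? a | P? b | P? t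
  ... | no ¬p | _ | _ | _ = no λ p → ¬p (p r)
  ... | yes _ | no ¬p | _ | _ = no λ p → ¬p (p a)
  ... | yes _ | yes _ | no ¬p | _ = no λ p → ¬p (p b)
  ... | yes _ | yes _ | yes _ | no ¬p = no λ p → ¬p (p t)
  ... | yes pr | yes pa | yes pb | yes pt = yes λ { r → pr ; a → pa ; b → pb ; t → pt }

𝔉₂-admissible : Admissible 𝔉₂
𝔉₂-admissible = record
  { isFinitePreorder = 𝔉₂-isFinitePreorder
  ; shape = λ w → inj₂ (forked w) }
  where
  forked : ∀ w → Forked {𝔉₂} w
  forked r r _ = inj₁ refl
  forked _ a _ = inj₂ λ { a _ → refl }
  forked _ b _ = inj₂ λ { b _ → refl }

ℜ₂-admissible : Admissible ℜ₂
ℜ₂-admissible = record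
  { isFinitePreorder = ℜ₂-isFinitePreorder
  ; shape = λ w → inj₁ (confluent w) }
  where
  confluent : ∀ w → Confluent {ℜ₂} w
  confluent w = t , λ { r _ → tt ; a _ → tt ; b _ → tt ; t _ → tt }

point : Frame
point = record { W = ⊤ ; _≼_ = λ _ _ → ⊤ }

point-isFinitePreorder : IsFinitePreorder point
point-isFinitePreorder = record
  { ≼-refl = λ _ → tt
  ; ≼-trans = λ _ _ _ _ _ → tt
  ; _≼?_ = λ _ _ → yes tt
  ; all? = λ P? → map′ (λ p _ → p) (λ p → p tt) (P? tt)
  }

module Fork = Kripke 𝔉₂-isFinitePreorder
module Rhombus = Kripke ℜ₂-isFinitePreorder
module Point = Kripke point-isFinitePreorder

admissible⇒L : ∀ A → (∀ {F} → Admissible F → ValidIn F A) → L-R₂F₂ A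
admissible⇒L A valid = valid ℜ₂-admissible , valid 𝔉₂-admissible

L-sub : ∀ σ A → L-R₂F₂ A → L-R₂F₂ (sub σ A)
L-sub σ A (R , F) = Rhombus.valid-sub σ A R , Fork.valid-sub σ A F

L-⇔-trans : ∀ {A B C} → L-R₂F₂ (A ⇔ B) → L-R₂F₂ (B ⇔ C) → L-R₂F₂ (A ⇔ C)
L-⇔-trans {A} {B} {C} (R , F) (R′ , F′) =
  Rhombus.⇔-trans-valid {A} {B} {C} R R′ , Fork.⇔-trans-valid {A} {B} {C} F F′

-- The instance preorder on substitutions

_≤ᵤ[_]_ : Subst → Fm → Subst → Set
τ ≤ᵤ[ A ] σ = Σ Subst λ α → EqL-on A (α ∘ₛ σ) τ

≤ᵤ-trans : ∀ {A ρ τ σ} → ρ ≤ᵤ[ A ] τ → τ ≤ᵤ[ A ] σ → ρ ≤ᵤ[ A ] σ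
≤ᵤ-trans {A} {ρ} {τ} {σ} (α , ατ≈ρ) (β , βσ≈τ) = α ∘ₛ β , λ x o →
  L-⇔-trans {sub (α ∘ₛ β) (σ x)} {sub α (τ x)} {ρ x}
    (subst (λ B → L-R₂F₂ (B ⇔ sub α (τ x))) (sym (sub-∘ α β (σ x)))
      (L-sub α (sub β (σ x) ⇔ τ x) (βσ≈τ x o)))
    (ατ≈ρ x o)

-- A directed preorder of unifiers without a greatest element has no minimal complete set: a member
-- above the join of `μ` and `ν` is above both, so keeping only the members above `ν` preserves
-- completeness and loses `ε`.
directed⇒noMinimalComplete : ∀ A →
  (∀ μ ν → Unifier A μ → Unifier A ν → Σ Subst λ κ → Unifier A κ × μ ≤ᵤ[ A ] κ × ν ≤ᵤ[ A ] κ) →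
  (∀ ε → Unifier A ε → Σ Subst λ ν → Unifier A ν × ¬ (ν ≤ᵤ[ A ] ε)) →
  Unifiable A → ¬ (Σ SubstSet λ Σs → MinimalComplete A Σs)
directed⇒noMinimalComplete A join escape (σ₀ , u₀) (Σs , (sound , complete) , minimal)
  with complete σ₀ u₀
... | ε , ε∈Σs , _ with escape ε (sound ε ε∈Σs)
...   | ν , uν , ν≰ε =
  minimal (Σ' , (λ _ → proj₁) , ((λ σ → sound σ ∘ proj₁) , complete′) , ε , ε∈Σs , ν≰ε ∘ proj₂)
  where
  Σ' : SubstSet
  Σ' σ = Σs σ × ν ≤ᵤ[ A ] σ

  complete′ : ∀ μ → Unifier A μ → Σ Subst λ σ → Σ' σ × μ ≤ᵤ[ A ] σ
  complete′ μ uμ =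
    let κ , uκ , μ≤κ , ν≤κ = join μ ν uμ uν
        σ , σ∈Σs , κ≤σ = complete κ uκ
    in σ , (σ∈Σs , ≤ᵤ-trans {A} {ν} {κ} {σ} ν≤κ κ≤σ) , ≤ᵤ-trans {A} {μ} {κ} {σ} μ≤κ κ≤σ

Φ : Fm
Φ = (var 0 ∨' var 1) ∧' ¬' ¬' var 0 ∧' ¬' ¬' var 1

-- Joining two unifiers

shift : Subst
shift i = var (suc i)

instantiate₀ : Fm → Subst
instantiate₀ B zero    = B
instantiate₀ B (suc i) = var i

instantiate₀-shift : ∀ B A → sub (instantiate₀ B) (sub shift A) ≡ A
instantiate₀-shift B A = trans (sym (sub-∘ (instantiate₀ B) shift A)) (sub-var A)

-- The variable 0 is the fresh `z`; `shift` keeps it out of the two unifiers.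
switch : Fm → Fm → Fm
switch P Q = (¬' ¬' var 0 ⇒ P) ∧' (¬' var 0 ⇒ Q)

join : Subst → Subst → Subst
join μ ν x = switch (sub shift (μ x)) (sub shift (ν x))

module _ {F : Frame} (adm : Admissible F) where
  open Frame F
  open Admissible adm
  open IsFinitePreorder isFinitePreorder
  open Kripke isFinitePreorder

  module _ {V : Valuation F} (mon : Monotone F V) where

    private
      _⊩_ : W → Fm → Set
      w ⊩ A = Forces F V w A

    -- All points above `w` see the bound `m`, so the value of `A` at `m` decides.
    confluent-wlem : ∀ {w} → Confluent {F} w → ∀ A → w ⊩ (¬' ¬' A ∨' ¬' A)
    confluent-wlem (m , top) A with forces? V m A
    ... | yes p = inj₁ λ v w≼v ¬p → ¬p m (top v w≼v) p
    ... | no ¬p = inj₂ λ v w≼v p → ¬p (persistent mon A (top v w≼v) p)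

    maximal-stable : ∀ {v} → (∀ u → v ≼ u → u ≡ v) → ∀ A → v ⊩ (¬' ¬' A) → v ⊩ A
    maximal-stable {v} max A ¬¬p with forces? V v A
    ... | yes p = p
    ... | no ¬p = ⊥-elim (¬¬p v (≼-refl v) λ u v≼u p → ¬p (subst (_⊩ A) (max u v≼u) p))

    switch-yes : ∀ {w} P Q → w ⊩ (¬' ¬' var 0) → w ⊩ P → w ⊩ switch P Q
    switch-yes P Q ¬¬z p = (λ v w≼v _ → persistent mon P w≼v p) ,
                           (λ v w≼v ¬z → ⊥-elim (¬¬z v w≼v ¬z))

    switch-no : ∀ {w} P Q → w ⊩ (¬' var 0) → w ⊩ Q → w ⊩ switch P Q
    switch-no P Q ¬z q =
      (λ v w≼v ¬¬z → ⊥-elim (¬¬z v (≼-refl v) λ u v≼u → ¬z u (≼-trans _ _ _ w≼v v≼u))) ,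
      (λ v w≼v _ → persistent mon Q w≼v q)

    -- Neither guard holds at `w` itself, and at the maximal points above it both `P` and `Q` hold.
    switch-mixed : ∀ {w} P Q → Forked {F} w → (∀ v → v ⊩ (¬' ¬' P)) → (∀ v → v ⊩ (¬' ¬' Q)) →
                   ¬ (w ⊩ (¬' ¬' var 0)) → ¬ (w ⊩ (¬' var 0)) → w ⊩ switch P Q
    switch-mixed {w} P Q forked ¬¬p ¬¬q n₁ n₂ = above P (¬' ¬' var 0) ¬¬p n₁ , above Q (¬' var 0) ¬¬q n₂
      where
      above : ∀ B C → (∀ v → v ⊩ (¬' ¬' B)) → ¬ (w ⊩ C) → w ⊩ (C ⇒ B)
      above B C ¬¬b ¬c v w≼v c with forked v w≼v
      ... | inj₁ v≡w = ⊥-elim (¬c (subst (_⊩ C) v≡w c))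
      ... | inj₂ max = maximal-stable max B (¬¬b v)

    switch-∨ : ∀ P P′ Q Q′ → (∀ v → v ⊩ (¬' ¬' P)) → (∀ v → v ⊩ (¬' ¬' Q)) →
               ∀ w → w ⊩ (P ∨' P′) → w ⊩ (Q ∨' Q′) → w ⊩ (switch P Q ∨' switch P′ Q′)
    switch-∨ P P′ Q Q′ ¬¬p ¬¬q w p∨p′ q∨q′
      with forces? V w (¬' ¬' var 0) | forces? V w (¬' var 0)
    ... | yes ¬¬z | _      = map-⊎ (switch-yes P Q ¬¬z) (switch-yes P′ Q′ ¬¬z) p∨p′
    ... | no _    | yes ¬z = map-⊎ (switch-no P Q ¬z) (switch-no P′ Q′ ¬z) q∨q′
    ... | no n₁   | no n₂ with shape w
    -- Either disjunct would do here; a confluent point cannot be mixed, by weak excluded middle for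
    -- `z`.
    ...   | inj₂ forked = inj₁ (switch-mixed P Q forked ¬¬p ¬¬q n₁ n₂)
    ...   | inj₁ conf with confluent-wlem conf (var 0)
    ...     | inj₁ ¬¬z = ⊥-elim (n₁ ¬¬z)
    ...     | inj₂ ¬z  = ⊥-elim (n₂ ¬z)

    ¬¬-switch : ∀ P Q {w} → w ⊩ (¬' ¬' P) → w ⊩ (¬' ¬' Q) → w ⊩ (¬' ¬' switch P Q)
    ¬¬-switch P Q ¬¬p ¬¬q = ¬¬-mono (P ∧' Q) (switch P Q)
      (λ v _ (p , q) → (λ u v≼u _ → persistent mon P v≼u p) , (λ u v≼u _ → persistent mon Q v≼u q))
      (¬¬-∧ mon P Q ¬¬p ¬¬q)

  join-valid : ∀ μ ν → ValidIn F (sub μ Φ) → ValidIn F (sub ν Φ) → ValidIn F (sub (join μ ν) Φ)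
  join-valid μ ν uμ uν V mon w =
    switch-∨ mon (m 0) (m 1) (n 0) (n 1) (λ v → proj₁ (proj₂ (um v))) (λ v → proj₁ (proj₂ (un v)))
      w (proj₁ (um w)) (proj₁ (un w)) ,
    ¬¬-switch mon (m 0) (n 0) (proj₁ (proj₂ (um w))) (proj₁ (proj₂ (un w))) ,
    ¬¬-switch mon (m 1) (n 1) (proj₂ (proj₂ (um w))) (proj₂ (proj₂ (un w)))
    where
    m n : ℕ → Fm
    m x = sub shift (μ x)
    n x = sub shift (ν x)
    um = valid-sub shift (sub μ Φ) uμ V mon
    un = valid-sub shift (sub ν Φ) uν V mon

  -- Substituting `⊤'` for `z` recovers the first unifier from the join, and `⊥'` the second.
  switch-⊤ : ∀ P Q → ValidIn F (((¬' ¬' ⊤' ⇒ P) ∧' (¬' ⊤' ⇒ Q)) ⇔ P)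
  switch-⊤ P Q V mon w =
    (λ v _ (f , _) → f v (≼-refl v) λ u _ ¬⊤ → ¬⊤ u (≼-refl u) λ _ _ ()) ,
    (λ v _ p → (λ u v≼u _ → persistent mon P v≼u p) ,
               (λ u v≼u ¬⊤ → ⊥-elim (¬⊤ u (≼-refl u) λ _ _ ())))

  switch-⊥ : ∀ P Q → ValidIn F (((¬' ¬' ⊥' ⇒ P) ∧' (¬' ⊥' ⇒ Q)) ⇔ Q)
  switch-⊥ P Q V mon w =
    (λ v _ (_ , f) → f v (≼-refl v) λ _ _ ()) ,
    (λ v _ q → (λ u v≼u ¬¬⊥ → ⊥-elim (¬¬⊥ u (≼-refl u) λ _ _ ())) ,
               (λ u v≼u _ → persistent mon Q v≼u q))

join-unifier : ∀ μ ν → Unifier Φ μ → Unifier Φ ν →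
               Σ Subst λ κ → Unifier Φ κ × μ ≤ᵤ[ Φ ] κ × ν ≤ᵤ[ Φ ] κ
join-unifier μ ν (Rμ , Fμ) (Rν , Fν) =
  join μ ν ,
  (join-valid ℜ₂-admissible μ ν Rμ Rν , join-valid 𝔉₂-admissible μ ν Fμ Fν) ,
  (instantiate₀ ⊤' , λ x _ → subst (λ B → L-R₂F₂ (sub (instantiate₀ ⊤') (join μ ν x) ⇔ B))
    (instantiate₀-shift ⊤' (μ x))
    (admissible⇒L _ λ adm → switch-⊤ adm _ _)) ,
  (instantiate₀ ⊥' , λ x _ → subst (λ B → L-R₂F₂ (sub (instantiate₀ ⊥') (join μ ν x) ⇔ B))
    (instantiate₀-shift ⊥' (ν x))
    (admissible⇒L _ λ adm → switch-⊥ adm _ _))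

-- Unifiers separating many maximal points

-- The variable 0 plays the role of q, and suc i that of pᵢ.
wlem< : ℕ → Fm
wlem< zero    = ⊤'
wlem< (suc k) = wlem< k ∧' (¬' ¬' var (suc k) ∨' ¬' var (suc k))

separating : ℕ → Subst
separating k zero    = wlem< k
separating k (suc _) = wlem< k ⇒ (var 0 ∨' ¬' var 0)

module _ {F : Frame} {V : Valuation F} {w : Frame.W F} where

  wlem<-intro : ∀ k → (∀ i → Forces F V w (¬' ¬' var (suc i) ∨' ¬' var (suc i))) → Forces F V w (wlem< k)
  wlem<-intro zero    p = λ _ _ ()
  wlem<-intro (suc k) p = wlem<-intro k p , p k

  wlem<-elim : ∀ {k i} → i < k → Forces F V w (wlem< k) → Forces F V w (¬' ¬' var (suc i) ∨' ¬' var (suc i))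
  wlem<-elim {suc k} (s≤s i≤k) (ps , p) with m≤n⇒m<n∨m≡n i≤k
  ... | inj₁ i<k  = wlem<-elim i<k ps
  ... | inj₂ refl = p

module _ {F : Frame} (adm : Admissible F) where
  open Frame F
  open Admissible adm
  open IsFinitePreorder isFinitePreorder
  open Kripke isFinitePreorder

  ¬¬-wlem< : ∀ {V} → Monotone F V → ∀ k w → Forces F V w (¬' ¬' wlem< k)
  ¬¬-wlem< mon zero    w = ¬¬-intro mon ⊤' λ _ _ ()
  ¬¬-wlem< mon (suc k) w = ¬¬-∧ mon (wlem< k) (¬' ¬' var (suc k) ∨' ¬' var (suc k))
    (¬¬-wlem< mon k w) (¬¬-wlem mon (var (suc k)) w)

  -- A confluent point forces `wlem< k`. If a forked point does not, every point above it that does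
  -- is maximal and so decides `q`. The last conjunct holds because `q∨¬q` implies the image of
  -- `var 1`.
  separating-valid : ∀ k → ValidIn F (sub (separating k) Φ)
  separating-valid k V mon w =
    dichotomy (shape w) ,
    ¬¬-wlem< mon k w ,
    ¬¬-mono q∨¬q (wlem< k ⇒ q∨¬q) (λ v _ p u v≼u _ → persistent mon q∨¬q v≼u p) (¬¬-lem {V} (var 0) w)
    where
    q∨¬q : Fm
    q∨¬q = var 0 ∨' ¬' var 0

    dichotomy : Confluent {F} w ⊎ Forked {F} w → Forces F V w (wlem< k ∨' (wlem< k ⇒ q∨¬q))
    dichotomy (inj₁ conf) = inj₁ (wlem<-intro k λ i → confluent-wlem adm mon conf (var (suc i)))
    dichotomy (inj₂ forked) with forces? V w (wlem< k)
    ... | yes p = inj₁ p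
    ... | no ¬p = inj₂ λ v w≼v p → above v p (forked v w≼v)
      where
      above : ∀ v → Forces F V v (wlem< k) → v ≡ w ⊎ (∀ u → v ≼ u → u ≡ v) → Forces F V v q∨¬q
      above v p (inj₁ v≡w) = ⊥-elim (¬p (subst (λ v → Forces F V v (wlem< k)) v≡w p))
      above v p (inj₂ max) = maximal-stable adm mon max q∨¬q (¬¬-lem {V} (var 0) v)

-- Forks with labelled leaves

leaf : ℕ → ℕ → Bool
leaf j zero    = true
leaf j (suc i) = does (i ≟ j)

-- Leaf `i` makes `q` true and, among the `pₙ`, only `pᵢ`. With `i = j` the leaves are
-- indistinguishable and the fork acts as a two-element chain.
fork : ℕ → ℕ → Valuation 𝔉₂
fork i j x r = false
fork i j x a = leaf i x
fork i j x b = leaf j x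

fork-monotone : ∀ i j → Monotone 𝔉₂ (fork i j)
fork-monotone i j x a a _ p = p
fork-monotone i j x b b _ p = p
fork-monotone i j x r _ _ ()

-- The conjunct for `pᵢ` fails at the root: `pᵢ` is true at `a` and false at `b`.
fork-refutes-wlem< : ∀ {k i j} → i < k → i ≢ j → ¬ Forces 𝔉₂ (fork i j) r (wlem< k)
fork-refutes-wlem< {k} {i} {j} i<k i≢j p with wlem<-elim i<k p
... | inj₁ ¬¬p = ¬¬p b tt λ { b _ q → i≢j (does-true (i ≟ j) q) }
... | inj₂ ¬p  = ¬p a tt (dec-true (i ≟ i) refl)

fork-forces-wlem< : ∀ k j → Forces 𝔉₂ (fork j j) r (wlem< k)
fork-forces-wlem< k j = wlem<-intro k λ i → case i (i ≟ j)
  where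
  case : ∀ i → Dec (i ≡ j) → Forces 𝔉₂ (fork j j) r (¬' ¬' var (suc i) ∨' ¬' var (suc i))
  case i (yes i≡j) = inj₁ λ
    { r _ ¬p → ¬p a tt (dec-true (i ≟ j) i≡j)
    ; a _ ¬p → ¬p a tt (dec-true (i ≟ j) i≡j)
    ; b _ ¬p → ¬p b tt (dec-true (i ≟ j) i≡j) }
  case i (no i≢j) = inj₂ λ
    { r _ ()
    ; a _ p → i≢j (does-true (i ≟ j) p)
    ; b _ p → i≢j (does-true (i ≟ j) p) }

-- The root forces `wlem< k` but leaves `q` undecided: `q` is false there and true at the leaves.
fork-refutes-lem : ∀ k j → ¬ Forces 𝔉₂ (fork j j) r (wlem< k ⇒ (var 0 ∨' ¬' var 0))
fork-refutes-lem k j p with p r tt (fork-forces-wlem< k j)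
... | inj₂ ¬q = ¬q a tt refl

-- Gluing collapsed forks into a rhombus

leafMap : (w : F₂W) → (∀ v → w ≤F v → v ≡ w) → PMorphism point 𝔉₂
leafMap w max = record
  { map = λ _ → w
  ; mono = λ _ _ _ → IsFinitePreorder.≼-refl 𝔉₂-isFinitePreorder w
  ; back = λ _ v w≼v → tt , tt , sym (max v w≼v)
  }

collapse-a : PMorphism 𝔉₂ ℜ₂
collapse-a = record
  { map = λ { r → a ; a → t ; b → t }
  ; mono = λ { r r _ → tt ; r a _ → tt ; r b _ → tt ; a a _ → tt ; b b _ → tt }
  ; back = λ { r a _ → r , tt , refl ; r t _ → a , tt , refl
             ; a t _ → a , tt , refl ; b t _ → b , tt , refl } }

collapse-b : PMorphism 𝔉₂ ℜ₂
collapse-b = record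
  { map = λ { r → b ; a → t ; b → t }
  ; mono = λ { r r _ → tt ; r a _ → tt ; r b _ → tt ; a a _ → tt ; b b _ → tt }
  ; back = λ { r b _ → r , tt , refl ; r t _ → a , tt , refl
             ; a t _ → a , tt , refl ; b t _ → b , tt , refl } }

-- Evaluating in the one-point frame makes the label under `α` independent of the fork in which the
-- leaf sits and of its side.
leafLabel : Subst → ℕ → ℕ → Bool
leafLabel α j x = (Point._⟨_⟩ (λ y _ → leaf j y) α) x tt

fork-label-a : ∀ α i j x → (fork i j Fork.⟨ α ⟩) x a ≡ leafLabel α i x
fork-label-a α i j x = sym (does-⇔
  (forces-map (leafMap a λ { a _ → refl }) (λ y _ → leaf i y) (fork i j) (α x) (λ _ _ _ → refl) tt)
  (Point.forces? _ tt (α x)) (Fork.forces? (fork i j) a (α x)))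

fork-label-b : ∀ α i j x → (fork i j Fork.⟨ α ⟩) x b ≡ leafLabel α j x
fork-label-b α i j x = sym (does-⇔
  (forces-map (leafMap b λ { b _ → refl }) (λ y _ → leaf j y) (fork i j) (α x) (λ _ _ _ → refl) tt)
  (Point.forces? _ tt (α x)) (Fork.forces? (fork i j) b (α x)))

module _ (α : Subst) (i j : ℕ) where

  -- The side `a` copies the root of `fork i j`, the side `b` the root of `fork i i`, and all leaves
  -- are identified with the top, which carries the label of leaf `i`. Making everything false at
  -- the root keeps the valuation monotone.
  rhombus : Valuation ℜ₂
  rhombus x r = false
  rhombus x a = (fork i j Fork.⟨ α ⟩) x r
  rhombus x b = (fork i i Fork.⟨ α ⟩) x r
  rhombus x t = leafLabel α i x

  rhombus-monotone : Monotone ℜ₂ rhombus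
  rhombus-monotone x r _ _ ()
  rhombus-monotone x a a _ p = p
  rhombus-monotone x a t _ p =
    trans (sym (fork-label-a α i j x)) (Fork.⟨⟩-monotone α (fork-monotone i j) x r a tt p)
  rhombus-monotone x b b _ p = p
  rhombus-monotone x b t _ p =
    trans (sym (fork-label-a α i i x)) (Fork.⟨⟩-monotone α (fork-monotone i i) x r a tt p)
  rhombus-monotone x t t _ p = p

  rhombus-a : ∀ A → (∀ x → x occursIn A → leafLabel α i x ≡ leafLabel α j x) →
              Forces ℜ₂ rhombus a A → Forces 𝔉₂ (fork i j) r (sub α A)
  rhombus-a A same = to (Fork.forces-sub (fork i j) α A r) ∘
    from (forces-map collapse-a _ rhombus A
      (λ { x o r → refl
         ; x o a → fork-label-a α i j x
         -- This leaf has index `j` but is sent to the top, labelled by `i`; here the labels must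
         -- agree.
         ; x o b → trans (fork-label-b α i j x) (sym (same x o)) }) r)

  rhombus-b : ∀ A → Forces ℜ₂ rhombus b A → Forces 𝔉₂ (fork i i) r (sub α A)
  rhombus-b A = to (Fork.forces-sub (fork i i) α A r) ∘
    from (forces-map collapse-b _ rhombus A
      (λ { x o r → refl
         ; x o a → fork-label-a α i i x
         ; x o b → fork-label-b α i i x }) r)

-- Pigeonhole: `suc (2 ^ m)` indices share the `2 ^ m` Boolean labellings of `m` variables, coded as
-- numbers by `funToFin`.
sameLabels : ∀ m (ℓ : ℕ → ℕ → Bool) →
  ∃ λ i → ∃ λ j → i < suc (2 ^ m) × i ≢ j × (∀ x → x < m → ℓ i x ≡ ℓ j x)
sameLabels m ℓ =
  let i , j , i<j , eq = pigeonhole (n<1+n (2 ^ m)) (λ i → funToFin (code i))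
  in toℕ i , toℕ j , toℕ<n i , <⇒≢ᶠ i<j ∘ toℕ-injectiveᶠ , λ x x<m →
    subst (λ x → ℓ (toℕ i) x ≡ ℓ (toℕ j) x) (toℕ-fromℕ< x<m) (decode i j eq (fromℕ< x<m))
  where
  code : Fin (suc (2 ^ m)) → Fin m → Fin 2
  code i x = Inverse.from 2↔Bool (ℓ (toℕ i) (toℕ x))

  decode : ∀ i j → funToFin (code i) ≡ funToFin (code j) → ∀ x → ℓ (toℕ i) (toℕ x) ≡ ℓ (toℕ j) (toℕ x)
  decode i j eq x = begin
    ℓ (toℕ i) (toℕ x)                                     ≡⟨ Inverse.strictlyInverseˡ 2↔Bool _ ⟨
    Inverse.to 2↔Bool (code i x)                          ≡⟨ cong (Inverse.to 2↔Bool) (finToFun-funToFin (code i) x) ⟨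
    Inverse.to 2↔Bool (finToFun (funToFin (code i)) x)    ≡⟨ cong (λ c → Inverse.to 2↔Bool (finToFun c x)) eq ⟩
    Inverse.to 2↔Bool (finToFun (funToFin (code j)) x)    ≡⟨ cong (Inverse.to 2↔Bool) (finToFun-funToFin (code j) x) ⟩
    Inverse.to 2↔Bool (code j x)                          ≡⟨ Inverse.strictlyInverseˡ 2↔Bool _ ⟩
    ℓ (toℕ j) (toℕ x)                                     ∎
    where open ≡-Reasoning

-- The bound involves `ε 0` alone, since only `ε 0` is evaluated on a fork with different leaves.
separating-escapes : ∀ ε → Unifier Φ ε →
  ¬ (separating (suc (2 ^ varBound (ε 0))) ≤ᵤ[ Φ ] ε)
separating-escapes ε (Rε , _) (α , eq)
  with sameLabels (varBound (ε 0)) (leafLabel α)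
... | i , j , i<k , i≢j , same
  with proj₁ (Rε (rhombus α i j) (rhombus-monotone α i j) r)
-- If `ε 0` holds at the root of the rhombus, it holds at `a`, so `fork i j` would force `wlem< k`.
... | inj₁ p = fork-refutes-wlem< i<k i≢j
  (proj₁ (proj₂ (eq 0 (∧l (∨l here))) (fork i j) (fork-monotone i j) r) r tt
    (rhombus-a α i j (ε 0) (λ x o → same x (occursIn⇒<varBound o))
      (Rhombus.persistent (rhombus-monotone α i j) (ε 0) {r} {a} tt p)))
-- If `ε 1` holds there, it holds at `b`, so the root of `fork i i` would force the second component
-- of `separating`.
... | inj₂ p = fork-refutes-lem (suc (2 ^ varBound (ε 0))) i
  (proj₁ (proj₂ (eq 1 (∧l (∨r here))) (fork i i) (fork-monotone i i) r) r tt
    (rhombus-b α i j (ε 1)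
      (Rhombus.persistent (rhombus-monotone α i j) (ε 1) {r} {b} tt p)))

separating-unifier : ∀ k → Unifier Φ (separating k)
separating-unifier k = admissible⇒L _ λ adm → separating-valid adm k

theorem5p8 : Unification.NullaryUnification L-R₂F₂
theorem5p8 = Φ , unifiable , directed⇒noMinimalComplete Φ join-unifier
  (λ ε uε → separating _ , separating-unifier _ , separating-escapes ε uε) unifiable
  where
  unifiable : Unifiable Φ
  unifiable = separating 0 , separating-unifier 0
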